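{- Let $A$ be a finite set with $|A|\ge 2$. For a transformation $\phi$ of $[n]$ ($n\ge2$) which is not a permutation, let $R(\phi)$ denote the ratio of the procedural complexity $\mathcal{L}(f^\phi)$ of $f^\phi:A^n\to A^n$ over the minimum length of a black box program computing $f^\phi$. Then $R(\phi)>2/3$ for every $n\ge 2$ and every $\phi:[n]\to[n]$ which is not a permutation. Conversely, for every $\epsilon>0$ there exist $n$ and a non-permutation $\phi:[n]\to[n]$ such that $R(\phi)<2/3+\epsilon$.
   Context: $[n]=\{1,\dots,n\}$; the image of $i$ under $\phi:[n]\to[n]$ is written $i\phi$. The manipulation of variables induced by $\phi$ is $f^\phi:A^n\to A^n$, $f^\phi(x_1,\dots,x_n)=(x_{1\phi},\dots,x_{n\phi})$. A transformation of $A^n$ is a map $f=(f_1,\dots,f_n):A^n\to A^n$; its coordinate function $f_i:A^n\to A$ is trivial if $f_i(x)=x_i$ for all $x$. An instruction is a transformation of $A^n$ with at most one nontrivial coordinate function. A program of length $L$ computing $f$ is a sequence of instructions $g^1,\dots,g^L$ with $f=g^L\circ\cdots\circ g^1$. The procedural complexity $\mathcal{L}(f)$ is the shortest length of a program computing $f$; the identity has procedural complexity $0$. A black box instruction is an instruction of the form $y_i\gets y_j$ for some $i,j\in[n]$, i.e. it replaces the $i$-th coordinate of the current tuple $y\in A^n$ by its $j$-th coordinate and leaves all other coordinates unchanged. A black box program is a program all of whose instructions are black box instructions (when $\phi$ is not a permutation, $f^\phi$ can always be computed by such a program). -}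

module Defs where

open import Data.Fin.Base using (Fin)
open import Data.Fin.Properties using (_≟_)
open import Data.Integer.Base using (+_)
open import Data.List.Base using (List; foldl; length)
open import Data.List.Relation.Unary.All using (All)
open import Data.Nat.Base using (ℕ; NonZero; _≤_)
open import Data.Nat.Properties using (≤-antisym)
open import Data.Product.Base using (_×_; _,_; ∃-syntax)
open import Data.Rational.Base using (ℚ; _/_)
open import Data.Vec.Base using (Vec; lookup; tabulate; _[_]≔_)
open import Data.Vec.Properties using (lookup∘update′)
open import Function.Definitions using (Bijective)
open import Level using (Level; _⊔_)
open import Relation.Binary.PropositionalEquality
  using (_≡_; _≗_; refl; sym; trans; cong)
open import Relation.Nullary using (¬_; yes; no; contradiction)

private
  variable
    a p : Level
    n : ℕ

IsPermutation : (Fin n → Fin n) → Set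
IsPermutation φ = Bijective _≡_ _≡_ φ

Transformation : Set a → ℕ → Set a
Transformation A n = Vec A n → Vec A n

manipulation : (A : Set a) → (Fin n → Fin n) → Transformation A n
manipulation A φ x = tabulate (λ i → lookup x (φ i))

TrivialAt : {A : Set a} → Transformation A n → Fin n → Set a
TrivialAt f i = ∀ x → lookup (f x) i ≡ lookup x i

IsInstruction : {A : Set a} → Transformation A n → Set a
IsInstruction f = ∀ i j → ¬ TrivialAt f i → ¬ TrivialAt f j → i ≡ j

IsBlackBoxInstruction : {A : Set a} → Transformation A n → Set a
IsBlackBoxInstruction g = ∃[ i ] ∃[ j ] (∀ y → g y ≡ y [ i ]≔ lookup y j)

blackBox⇒instruction : {A : Set a} {g : Transformation A n} →
                       IsBlackBoxInstruction g → IsInstruction g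
blackBox⇒instruction {g = g} (i , j , eq) k l ¬k ¬l =
  trans (written k ¬k) (sym (written l ¬l))
  where
  written : ∀ k → ¬ TrivialAt g k → k ≡ i
  written k ¬triv with k ≟ i
  ... | yes k≡i = k≡i
  ... | no  k≢i = contradiction
    (λ x → trans (cong (λ v → lookup v k) (eq x)) (lookup∘update′ k≢i x (lookup x j)))
    ¬triv

-- The head of the list is executed first: run (g¹ ∷ … ∷ gᴸ ∷ []) = gᴸ ∘ … ∘ g¹.
run : {A : Set a} → List (Transformation A n) → Transformation A n
run gs x = foldl (λ y g → g y) x gs

IsProgramFor : {A : Set a} → Transformation A n → List (Transformation A n) → Set a
IsProgramFor f gs = All IsInstruction gs × run gs ≗ f

IsBlackBoxProgramFor : {A : Set a} → Transformation A n → List (Transformation A n) → Set a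
IsBlackBoxProgramFor f gs = All IsBlackBoxInstruction gs × run gs ≗ f

IsMinLength : {B : Set a} → (List B → Set p) → ℕ → Set (a ⊔ p)
IsMinLength P ℓ = (∃[ gs ] (P gs × length gs ≡ ℓ)) × (∀ gs → P gs → ℓ ≤ length gs)

IsMinLength-unique : {B : Set a} {P : List B → Set p} {k ℓ : ℕ} →
                     IsMinLength P k → IsMinLength P ℓ → k ≡ ℓ
IsMinLength-unique ((gs , Pgs , refl) , min) ((hs , Phs , refl) , min′) =
  ≤-antisym (min hs Phs) (min′ gs Pgs)

IsProceduralComplexity : {A : Set a} → Transformation A n → ℕ → Set a
IsProceduralComplexity f = IsMinLength (IsProgramFor f)

IsBlackBoxComplexity : {A : Set a} → Transformation A n → ℕ → Set a
IsBlackBoxComplexity f = IsMinLength (IsBlackBoxProgramFor f)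

-- R(φ) = r, as a functional relation: both minima exist, the second one is
-- nonzero, and r is their quotient.
record IsRatio (A : Set a) (φ : Fin n → Fin n) (r : ℚ) : Set a where
  field
    complexity         : ℕ
    blackBoxComplexity : ℕ
    isComplexity         : IsProceduralComplexity (manipulation A φ) complexity
    isBlackBoxComplexity : IsBlackBoxComplexity (manipulation A φ) blackBoxComplexity
    .{{nonZero}}         : NonZero blackBoxComplexity
    ratio                : r ≡ + complexity / blackBoxComplexity

{-# OPTIONS --safe #-}
-- Let s be the number of points moved by φ.  A program for f^φ must modify each
-- of these s coordinates, so 𝓛(f^φ) ≥ s.  On the other hand some index t lies
-- outside the image of φ, and y_t serves as scratch space for a black box program
-- that copies the values along the arrows of φ; one extra copy is needed for each
-- connected component that is a cycle of length ≥ 2, hence fewer than s / 2 of them.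
--
-- The bound is approached by m disjoint transpositions together with one collapsed
-- point.  A black box program must save a value of each transposition separately,
-- which costs 3m + 1 copies, whereas 2m + 2 general instructions suffice: a sum
-- modulo |A| over all the transpositions is stored once, and each of the overwritten
-- values can be recovered from it.
--
-- Both minima exist constructively because there are only finitely many
-- transformations of Aⁿ up to pointwise equality.

module Submission where

open import Defs
open import Data.Bool.Base using (if_then_else_)
open import Data.Empty using (⊥)
open import Data.Fin.Base using (Fin; zero; suc; toℕ; punchOut; opposite; combine; remQuot;
  finToFun; funToFin)
open import Data.Fin.Patterns using (0F; 1F)
open import Data.Fin.Properties using (_≟_; any?; all?; suc-injective; <⇒≢; pigeonhole;
  punchOut-injective; toℕ-injective; toℕ-fromℕ<; toℕ<n; finToFun-funToFin; opposite-involutive;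
  combine-remQuot; remQuot-combine)
open import Data.Integer.Base as ℤ using (+_; -[1+_])
import Data.Integer.Properties as ℤ
open import Data.List.Base using (List; []; _∷_; length; allFin)
open import Data.List.Membership.Propositional.Properties using (∈-allFin)
open import Data.List.Properties using (length-tabulate)
open import Data.List.Relation.Unary.All as All using (All; []; _∷_)
open import Data.List.Relation.Unary.AllPairs using ([]; _∷_)
open import Data.List.Relation.Unary.Any using (here; there)
open import Data.List.Relation.Unary.Unique.Propositional using (Unique)
open import Data.List.Relation.Unary.Unique.Propositional.Properties using (allFin⁺)
open import Data.Nat.Base as ℕ using (ℕ; zero; suc; _≤_; z≤n; s≤s; _∸_; NonZero)
open import Data.Nat.DivMod using (_mod_; _%_; %-distribˡ-+; m%n%n≡m%n; [m+n]%n≡m%n; m<n⇒m%n≡m)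
open import Data.Nat.Induction using (<-wellFounded)
open import Data.Nat.Properties using (≤-refl; ≤-reflexive; ≤-trans; ≤-antisym; <⇒≤; ≮⇒≥; n≤1+n;
  m≤n⇒m≤1+n; m≤m+n; m≤n+m; m<m+n; m+[n∸m]≡n; +-comm; +-assoc; +-suc; +-mono-≤; +-mono-<-≤;
  +-mono-≤-<; +-monoˡ-≤; +-monoʳ-≤; *-comm; *-distribˡ-+; *-mono-≤; *-monoˡ-≤; *-monoʳ-≤;
  anyUpTo?; module ≤-Reasoning)
open import Data.Nat.Tactic.RingSolver using (solve-∀)
open import Data.Product.Base using (_×_; _,_; ∃-syntax; Σ-syntax; proj₁; proj₂; map₂)
open import Data.Rational.Base using (ℚ; mkℚ; _/_; _<_; *<*; _+_; 0ℚ; ↧ₙ_; toℚᵘ)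
open import Data.Rational.Properties using (toℚᵘ-cancel-<; toℚᵘ-fromℚᵘ; toℚᵘ-homo-+)
import Data.Rational.Unnormalised.Base as ℚᵘ
import Data.Rational.Unnormalised.Properties as ℚᵘ
open import Data.Vec.Base using (Vec; lookup; tabulate; replicate; _[_]≔_)
open import Data.Vec.Properties using (lookup∘update; lookup∘update′; lookup∘tabulate;
  tabulate∘lookup; tabulate-cong; lookup-replicate; ≡-dec)
open import Function.Base using (_∘_; id)
open import Function.Bundles using (_↔_; module Inverse)
open import Function.Definitions using (Injective; Surjective)
open import Induction.WellFounded using (Acc; acc)
open import Level using (Level)
open import Relation.Binary.PropositionalEquality using (_≡_; _≢_; _≗_; refl; sym; trans;
  cong; cong₂; subst; subst₂; module ≡-Reasoning)
open import Relation.Nullary using (¬_; Dec; yes; no; does; contradiction; ¬?; _×-dec_; _→-dec_; map′)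
open import Relation.Nullary.Decidable using (decidable-stable)
open import Relation.Unary using (Pred; Decidable)

private
  variable
    a p r : Level
    m n ℓ : ℕ

-- Counting the elements of a finite set with a decidable property

bit : {P : Set p} → Dec P → ℕ
bit P? = if does P? then 1 else 0

bit≤1 : {P : Set p} (P? : Dec P) → bit P? ≤ 1
bit≤1 (yes _) = s≤s z≤n
bit≤1 (no  _) = z≤n

bit-mono : {P : Set p} {Q : Set r} (P? : Dec P) (Q? : Dec Q) → (P → Q) → bit P? ≤ bit Q?
bit-mono (no  _) _       P⇒Q = z≤n
bit-mono (yes _) (yes _) P⇒Q = s≤s z≤n
bit-mono (yes p) (no ¬q) P⇒Q = contradiction (P⇒Q p) ¬q

bit-strict : {P : Set p} {Q : Set r} (P? : Dec P) (Q? : Dec Q) → ¬ P → Q → bit P? ℕ.< bit Q?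
bit-strict (yes p) _       ¬p q = contradiction p ¬p
bit-strict (no  _) (yes _) ¬p q = s≤s z≤n
bit-strict (no  _) (no ¬q) ¬p q = contradiction q ¬q

count : {P : Pred (Fin n) p} → Decidable P → ℕ
count {n = zero}  P? = 0
count {n = suc n} P? = bit (P? zero) ℕ.+ count (P? ∘ suc)

count-mono : {P : Pred (Fin n) p} {Q : Pred (Fin n) r} (P? : Decidable P) (Q? : Decidable Q) →
             (∀ i → P i → Q i) → count P? ≤ count Q?
count-mono {n = zero}  P? Q? P⇒Q = z≤n
count-mono {n = suc n} P? Q? P⇒Q =
  +-mono-≤ (bit-mono (P? zero) (Q? zero) (P⇒Q zero))
             (count-mono (P? ∘ suc) (Q? ∘ suc) (P⇒Q ∘ suc))

-- The exceptional index `k` adds at most one to the left count. In this form the lower bounds use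
-- that an instruction affects a single coordinate.
count-mono-except : {P : Pred (Fin n) p} {Q : Pred (Fin n) r}
                    (P? : Decidable P) (Q? : Decidable Q) (k : Fin n) →
                    (∀ i → i ≢ k → P i → Q i) → count P? ≤ suc (count Q?)
count-mono-except P? Q? zero P⇒Q =
  +-mono-≤ (bit≤1 (P? zero))
    (≤-trans (count-mono (P? ∘ suc) (Q? ∘ suc) (λ i → P⇒Q (suc i) λ ())) (m≤n+m _ _))
count-mono-except P? Q? (suc k) P⇒Q = ≤-trans
  (+-mono-≤ (bit-mono (P? zero) (Q? zero) (P⇒Q zero λ ()))
    (count-mono-except (P? ∘ suc) (Q? ∘ suc) k
      (λ i i≢k → P⇒Q (suc i) λ { refl → i≢k refl })))
  (≤-reflexive (+-suc _ _))

count-strict : {P : Pred (Fin n) p} {Q : Pred (Fin n) r} (P? : Decidable P) (Q? : Decidable Q) (k : Fin n) →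
               (∀ i → P i → Q i) → ¬ P k → Q k → count P? ℕ.< count Q?
count-strict P? Q? zero P⇒Q ¬p q =
  +-mono-<-≤ (bit-strict (P? zero) (Q? zero) ¬p q)
               (count-mono (P? ∘ suc) (Q? ∘ suc) (P⇒Q ∘ suc))
count-strict P? Q? (suc k) P⇒Q ¬p q =
  +-mono-≤-< (bit-mono (P? zero) (Q? zero) (P⇒Q zero))
               (count-strict (P? ∘ suc) (Q? ∘ suc) k (P⇒Q ∘ suc) ¬p q)

count-all : {P : Pred (Fin n) p} (P? : Decidable P) → (∀ i → P i) → count P? ≡ n
count-all {n = zero}  P? all = refl
count-all {n = suc n} P? all with P? zero
... | yes _ = cong suc (count-all (P? ∘ suc) (all ∘ suc))
... | no ¬p = contradiction (all zero) ¬p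

count-none : {P : Pred (Fin n) p} (P? : Decidable P) → (∀ i → ¬ P i) → count P? ≡ 0
count-none {n = zero}  P? none = refl
count-none {n = suc n} P? none with P? zero
... | yes p = contradiction p (none zero)
... | no  _ = count-none (P? ∘ suc) (none ∘ suc)

-- Transformations of a finite set

Free : (Fin n → Fin n) → Fin n → Set
Free φ t = ∀ k → φ k ≢ t

free? : (φ : Fin n → Fin n) → Decidable (Free φ)
free? φ t = all? (λ k → ¬? (φ k ≟ t))

¬free⇒preimage : (φ : Fin n → Fin n) {t : Fin n} → ¬ Free φ t → ∃[ k ] φ k ≡ t
¬free⇒preimage φ {t} ¬free with any? (λ k → φ k ≟ t)
... | yes pre = pre
... | no ¬pre = contradiction (λ k eq → ¬pre (k , eq)) ¬free

-- If nothing were free, φ would still be surjective after deleting i from its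
-- domain, against the pigeonhole principle.
collision⇒free : (φ : Fin n → Fin n) {i j : Fin n} → i ≢ j → φ i ≡ φ j → ∃[ t ] Free φ t
collision⇒free {n = suc n} φ {i} {j} i≢j φi≡φj with any? (free? φ)
... | yes free = free
... | no ¬free =
  let t , u , t<u , eq = pigeonhole ≤-refl (punchOut ∘ i≢pre)
  in contradiction
       (trans (sym (φ-pre t))
         (trans (cong φ (punchOut-injective (i≢pre t) (i≢pre u) eq)) (φ-pre u)))
       (<⇒≢ t<u)
  where
  preimage : ∀ t → ∃[ k ] (i ≢ k × φ k ≡ t)
  preimage t with ¬free⇒preimage φ (λ f → ¬free (t , f))
  ... | k , φk≡t with i ≟ k
  ...   | yes refl = j , i≢j , trans (sym φi≡φj) φk≡t
  ...   | no  i≢k  = k , i≢k , φk≡t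

  i≢pre = λ t → proj₁ (proj₂ (preimage t))
  φ-pre = λ t → proj₂ (proj₂ (preimage t))

-- With nothing free `φ` is surjective, and also injective, since any collision would produce a free
-- index.
nonPermutation⇒free : (φ : Fin n → Fin n) → ¬ IsPermutation φ → ∃[ t ] Free φ t
nonPermutation⇒free φ ¬perm with any? (free? φ)
... | yes free = free
... | no ¬free = contradiction ((λ {x} {y} → injective {x} {y}) , surjective) ¬perm
  where
  injective : Injective _≡_ _≡_ φ
  injective {i} {j} eq with i ≟ j
  ... | yes i≡j = i≡j
  ... | no  i≢j = contradiction (collision⇒free φ i≢j eq) ¬free

  surjective : Surjective _≡_ _≡_ φ
  surjective t = map₂ (λ eq → λ { refl → eq }) (¬free⇒preimage φ (λ f → ¬free (t , f)))

support? : (φ : Fin n → Fin n) → Decidable (λ k → φ k ≢ k)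
support? φ k = ¬? (φ k ≟ k)

∣support∣ : (Fin n → Fin n) → ℕ
∣support∣ φ = count (support? φ)

-- Black box programs as products of index maps

overwrite : Fin n → Fin n → Fin n → Fin n
overwrite i j k with k ≟ i
... | yes _ = j
... | no  _ = k

overwrite-≡ : (i j : Fin n) → overwrite i j i ≡ j
overwrite-≡ i j with i ≟ i
... | yes _  = refl
... | no i≢i = contradiction refl i≢i

overwrite-≢ : {i k : Fin n} (j : Fin n) → k ≢ i → overwrite i j k ≡ k
overwrite-≢ {i = i} {k} j k≢i with k ≟ i
... | yes k≡i = contradiction k≡i k≢i
... | no  _   = refl

-- The copy from `j` to `i` is executed first and the rest realises `ψ`, so its `overwrite` is
-- applied after `ψ`.
data Compiles {n : ℕ} : (Fin n → Fin n) → ℕ → Set where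
  halt : ∀ {φ} → φ ≗ id → Compiles φ 0
  copy : ∀ {φ ψ} i j → overwrite i j ∘ ψ ≗ φ → Compiles ψ ℓ → Compiles φ (suc ℓ)

-- The task that remains after `t` has received the value of `v`: whoever needs that value reads it
-- from `t`, which makes `v` free.
redirect : Fin n → Fin n → (Fin n → Fin n) → Fin n → Fin n
redirect t v φ k with φ k ≟ v
... | yes _ = t
... | no  _ = φ k

redirect-≡ : (t : Fin n) {v : Fin n} (φ : Fin n → Fin n) {k : Fin n} →
             φ k ≡ v → redirect t v φ k ≡ t
redirect-≡ t {v} φ {k} eq with φ k ≟ v
... | yes _  = refl
... | no neq = contradiction eq neq

redirect-≢ : (t : Fin n) {v : Fin n} (φ : Fin n → Fin n) {k : Fin n} →
             φ k ≢ v → redirect t v φ k ≡ φ k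
redirect-≢ t {v} φ {k} neq with φ k ≟ v
... | yes eq = contradiction eq neq
... | no _   = refl

-- The task that remains once `t` holds its final value and only has to keep it.
retire : Fin n → (Fin n → Fin n) → Fin n → Fin n
retire t φ k with k ≟ t
... | yes _ = t
... | no  _ = φ k

retire-≡ : (t : Fin n) (φ : Fin n → Fin n) → retire t φ t ≡ t
retire-≡ t φ with t ≟ t
... | yes _  = refl
... | no neq = contradiction refl neq

retire-≢ : {t : Fin n} (φ : Fin n → Fin n) {k : Fin n} → k ≢ t → retire t φ k ≡ φ k
retire-≢ {t = t} φ {k} neq with k ≟ t
... | yes eq = contradiction eq neq
... | no _   = refl

module _ {φ : Fin n → Fin n} {t : Fin n} (free : Free φ t) where

  copy-redirect : ∀ v → Compiles (redirect t v φ) ℓ → Compiles φ (suc ℓ)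
  copy-redirect v = copy t v eq
    where
    eq : overwrite t v ∘ redirect t v φ ≗ φ
    eq k with φ k ≟ v
    ... | yes φk≡v = trans (overwrite-≡ t v) (sym φk≡v)
    ... | no  _    = overwrite-≢ v (free k)

  copy-retire : Compiles (retire t φ) ℓ → Compiles φ (suc ℓ)
  copy-retire = copy t (φ t) eq
    where
    eq : overwrite t (φ t) ∘ retire t φ ≗ φ
    eq k with k ≟ t
    ... | yes refl = overwrite-≡ t (φ t)
    ... | no  _    = overwrite-≢ (φ t) (free k)

  ∣support∣-retire : ∣support∣ (retire t φ) ℕ.< ∣support∣ φ
  ∣support∣-retire = count-strict (support? (retire t φ)) (support? φ) t ⊆
    (λ neq → neq (retire-≡ t φ)) (free t)
    where
    ⊆ : ∀ k → retire t φ k ≢ k → φ k ≢ k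
    ⊆ k neq eq with k ≟ t
    ... | yes refl = neq refl
    ... | no  _    = neq eq

  redirect-free : {v : Fin n} → t ≢ v → Free (redirect t v φ) v
  redirect-free {v} t≢v k with φ k ≟ v
  ... | yes _  = t≢v
  ... | no neq = neq

  -- The only fixed point that a redirection could disturb is `v`, and `v` is assumed to be moved.
  support-redirect : {v : Fin n} → φ v ≢ v → ∀ k → redirect t v φ k ≢ k → φ k ≢ k
  support-redirect {v} φv≢v k neq eq with φ k ≟ v
  ... | yes φk≡v = φv≢v (subst (λ i → φ i ≡ i) (trans (sym eq) φk≡v) eq)
  ... | no  _    = neq eq

  ∣support∣-redirect≤ : {v : Fin n} → φ v ≢ v → ∣support∣ (redirect t v φ) ≤ ∣support∣ φ
  ∣support∣-redirect≤ {v} φv≢v =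
    count-mono (support? (redirect t v φ)) (support? φ) (support-redirect φv≢v)

  ∣support∣-redirect< : {v : Fin n} → φ t ≡ v → φ v ≢ v →
                        ∣support∣ (redirect t v φ) ℕ.< ∣support∣ φ
  ∣support∣-redirect< {v} φt≡v φv≢v =
    count-strict (support? (redirect t v φ)) (support? φ) t (support-redirect φv≢v)
      (λ neq → neq (redirect-≡ t φ φt≡v)) (free t)

-- Overwriting a free t by its final value settles t.  When that value φ t is a
-- fixed point this might leave a permutation; a chain c₁ ↦ c₂ elsewhere is then
-- cut open with t as scratch space, settling c₁ and c₂ in three copies.
compile : (φ : Fin n → Fin n) → ∃[ t ] Free φ t →
          ∃[ ℓ ] (Compiles φ ℓ × 2 ℕ.* ℓ ℕ.< 3 ℕ.* ∣support∣ φ)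
compile {n = n} φ = go φ (<-wellFounded _)
  where
  -- Spending `e` copies to settle `d` moved points is affordable at the rate of three copies per
  -- two points; the strictness is inherited from the remaining program.
  bound : ∀ d {s s′ ℓ} → d ℕ.+ s′ ≤ s → ∀ e → 2 ℕ.* e ≤ 3 ℕ.* d →
          2 ℕ.* ℓ ℕ.< 3 ℕ.* s′ → 2 ℕ.* (e ℕ.+ ℓ) ℕ.< 3 ℕ.* s
  bound d {s} {s′} {ℓ} ds′≤s e 2e≤3d 2ℓ<3s′ = begin-strict
    2 ℕ.* (e ℕ.+ ℓ)          ≡⟨ *-distribˡ-+ 2 e ℓ ⟩
    2 ℕ.* e ℕ.+ 2 ℕ.* ℓ      <⟨ +-mono-≤-< 2e≤3d 2ℓ<3s′ ⟩
    3 ℕ.* d ℕ.+ 3 ℕ.* s′     ≡⟨ *-distribˡ-+ 3 d s′ ⟨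
    3 ℕ.* (d ℕ.+ s′)         ≤⟨ *-monoʳ-≤ 3 ds′≤s ⟩
    3 ℕ.* s                  ∎
    where open ≤-Reasoning

  go : (φ : Fin n → Fin n) → Acc ℕ._<_ (∣support∣ φ) → ∃[ t ] Free φ t →
       ∃[ ℓ ] (Compiles φ ℓ × 2 ℕ.* ℓ ℕ.< 3 ℕ.* ∣support∣ φ)
  go φ (acc rec) (t , free) with φ (φ t) ≟ φ t
  ... | no φφt≢φt =
    -- One copy settles `t`, and the vacated index `φ t` is the next scratch space.
    let drop           = ∣support∣-redirect< free refl φφt≢φt
        ℓ , prog , ℓ<  = go (redirect t (φ t) φ) (rec drop)
                           (φ t , redirect-free free (free t ∘ sym))
    in suc ℓ , copy-redirect free (φ t) prog , bound 1 drop 1 (s≤s (s≤s z≤n)) ℓ<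
  ... | yes φφt≡φt
    with any? (λ c → ¬? (c ≟ t) ×-dec ¬? (φ c ≟ c) ×-dec free? φ c)
       | any? (λ c → ¬? (c ≟ t) ×-dec ¬? (φ c ≟ c))
  -- A second moved free index `c` stays free, so `t` can be retired safely.
  ...   | yes (c , c≢t , _ , free-c) | _ =
    let drop          = ∣support∣-retire free
        ℓ , prog , ℓ< = go (retire t φ) (rec drop) (c , free′)
    in suc ℓ , copy-retire free prog , bound 1 drop 1 (s≤s (s≤s z≤n)) ℓ<
    where
    free′ : Free (retire t φ) c
    free′ k with k ≟ t
    ... | yes _ = c≢t ∘ sym
    ... | no  _ = free-c k
  -- Only `t` is moved, so a single copy finishes; here `2 < 3` provides the strict inequality.
  ...   | no _ | no ¬moved = 1 , copy-retire free (halt id′) ,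
    *-monoʳ-≤ 3 (≤-trans (s≤s z≤n) (∣support∣-retire free))
    where
    id′ : retire t φ ≗ id
    id′ k with k ≟ t
    ... | yes k≡t = sym k≡t
    ... | no  k≢t = decidable-stable (φ k ≟ k) (λ φk≢k → ¬moved (k , k≢t , φk≢k))
  ...   | no ¬freeMoved | yes (c₂ , c₂≢t , φc₂≢c₂) =
    -- Preimages of `c₁` now read from `t`, so `t` may no longer be free. But `t` and `φ t` are
    -- still both sent to `φ t`, and this collision guarantees a free index.
    let ℓ , prog , ℓ< = go ψ₃ (rec (≤-trans (n≤1+n _) drop))
                          (collision⇒free ψ₃ (free t ∘ sym) collision)
    in 3 ℕ.+ ℓ ,
       copy-redirect free c₁ (copy-redirect free₁ c₂ (copy-retire free₂ prog)) ,
       bound 2 drop 3 ≤-refl ℓ<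
    where
    preimage : ∃[ k ] φ k ≡ c₂
    preimage = ¬free⇒preimage φ (λ free-c₂ → ¬freeMoved (c₂ , c₂≢t , φc₂≢c₂ , free-c₂))

    c₁ = proj₁ preimage
    j  = φ t

    φc₁≡c₂ : φ c₁ ≡ c₂
    φc₁≡c₂ = proj₂ preimage

    c₁≢c₂ : c₁ ≢ c₂
    c₁≢c₂ eq = φc₂≢c₂ (trans (cong φ (sym eq)) φc₁≡c₂)

    φc₁≢c₁ : φ c₁ ≢ c₁
    φc₁≢c₁ eq = c₁≢c₂ (trans (sym eq) φc₁≡c₂)

    j≢c₁ : j ≢ c₁
    j≢c₁ eq = φc₁≢c₁ (subst (λ i → φ i ≡ i) eq φφt≡φt)

    j≢c₂ : j ≢ c₂
    j≢c₂ eq = φc₂≢c₂ (subst (λ i → φ i ≡ i) eq φφt≡φt)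

    t≢c₁ : t ≢ c₁
    t≢c₁ eq = j≢c₂ (trans (cong φ eq) φc₁≡c₂)

    ψ₁ = redirect t c₁ φ
    ψ₂ = redirect c₁ c₂ ψ₁
    ψ₃ = retire c₂ ψ₂

    free₁ : Free ψ₁ c₁
    free₁ = redirect-free free t≢c₁

    free₂ : Free ψ₂ c₂
    free₂ = redirect-free free₁ c₁≢c₂

    ψ₁c₁≡c₂ : ψ₁ c₁ ≡ c₂
    ψ₁c₁≡c₂ = trans (redirect-≢ t φ φc₁≢c₁) φc₁≡c₂

    ψ₁c₂≢c₂ : ψ₁ c₂ ≢ c₂
    ψ₁c₂≢c₂ with φ c₂ ≟ c₁
    ... | yes _ = c₂≢t ∘ sym
    ... | no  _ = φc₂≢c₂

    -- The first copy merely saves the value of `c₁` in `t`; the second settles `c₁` and the third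
    -- settles `c₂`.
    drop : 2 ℕ.+ ∣support∣ ψ₃ ≤ ∣support∣ φ
    drop = begin
      2 ℕ.+ ∣support∣ ψ₃ ≤⟨ s≤s (∣support∣-retire free₂) ⟩
      1 ℕ.+ ∣support∣ ψ₂ ≤⟨ ∣support∣-redirect< free₁ ψ₁c₁≡c₂ ψ₁c₂≢c₂ ⟩
      ∣support∣ ψ₁       ≤⟨ ∣support∣-redirect≤ free φc₁≢c₁ ⟩
      ∣support∣ φ        ∎
      where open ≤-Reasoning

    ψ₃-on-fibre : ∀ {k} → φ k ≡ j → k ≢ c₂ → ψ₃ k ≡ j
    ψ₃-on-fibre {k} φk≡j k≢c₂ = begin
      ψ₃ k ≡⟨ retire-≢ ψ₂ k≢c₂ ⟩
      ψ₂ k ≡⟨ redirect-≢ c₁ ψ₁ (λ eq → j≢c₂ (trans (sym ψ₁k≡j) eq)) ⟩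
      ψ₁ k ≡⟨ ψ₁k≡j ⟩
      j    ∎
      where
      open ≡-Reasoning
      ψ₁k≡j : ψ₁ k ≡ j
      ψ₁k≡j = trans (redirect-≢ t φ (λ eq → j≢c₁ (trans (sym φk≡j) eq))) φk≡j

    collision : ψ₃ t ≡ ψ₃ j
    collision = trans (ψ₃-on-fibre refl (c₂≢t ∘ sym)) (sym (ψ₃-on-fibre φφt≡φt j≢c₂))

-- Potential lower bound for black box programs

-- Class 0 collects the indices outside the m distinguished classes.
record MovedClasses (φ : Fin n → Fin n) (m : ℕ) : Set where
  field
    class          : Fin n → Fin (suc m)
    member         : Fin m → Fin n
    class-member   : ∀ k → class (member k) ≡ suc k
    class-φ        : ∀ i → class (φ i) ≡ class i
    class-moved    : ∀ {k} i → class i ≡ suc k → φ i ≢ i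
    class-preimage : ∀ {k} i → class i ≡ suc k → ∃[ i′ ] φ i′ ≡ i

module Potential {φ : Fin n → Fin n} (classes : MovedClasses φ m) where

  open MovedClasses classes

  -- In state `σ`, coordinate `i` holds the input value with index `σ i`. A class is untouched while
  -- its values occur nowhere but in their original places.
  Untouched : (Fin n → Fin n) → Fin m → Set
  Untouched σ k = ∀ i → class (σ i) ≡ suc k → σ i ≡ i

  untouched? : (σ : Fin n → Fin n) → Decidable (Untouched σ)
  untouched? σ k = all? (λ i → (class (σ i) ≟ suc k) →-dec (σ i ≟ i))

  wrong? : (σ : Fin n → Fin n) → Decidable (λ i → σ i ≢ φ i)
  wrong? σ i = ¬? (σ i ≟ φ i)

  -- The second summand charges one additional copy for each class that has yet to be opened.
  potential : (Fin n → Fin n) → ℕ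
  potential σ = count (wrong? σ) ℕ.+ count (untouched? σ)

  potential-id : potential id ≡ ∣support∣ φ ℕ.+ m
  potential-id = cong₂ ℕ._+_
    (≤-antisym (count-mono (wrong? id) (support? φ) (λ _ neq → neq ∘ sym))
                 (count-mono (support? φ) (wrong? id) (λ _ neq → neq ∘ sym)))
    (count-all (untouched? id) (λ _ _ _ → refl))

  -- In the final state a member of each class holds a different value of the same class, so no
  -- class is untouched.
  potential-done : ∀ {σ} → σ ≗ φ → potential σ ≡ 0
  potential-done {σ} σ≗φ = cong₂ ℕ._+_
    (count-none (wrong? σ) (λ i neq → neq (σ≗φ i)))
    (count-none (untouched? σ) λ k unt →
      let i       = member k
          class-σ = trans (cong class (σ≗φ i)) (trans (class-φ i) (class-member k))
      in class-moved i (class-member k) (trans (sym (σ≗φ i)) (unt i class-σ)))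

  module _ (σ : Fin n → Fin n) (i j : Fin n) where

    private
      σ′ : Fin n → Fin n
      σ′ = σ ∘ overwrite i j

    wrong-mono : σ j ≢ φ i → count (wrong? σ) ≤ count (wrong? σ′)
    wrong-mono σj≢φi = count-mono (wrong? σ) (wrong? σ′) ⊆
      where
      ⊆ : ∀ l → σ l ≢ φ l → σ′ l ≢ φ l
      ⊆ l neq with l ≟ i
      ... | yes refl = σj≢φi
      ... | no  _    = neq

    wrong-drop : count (wrong? σ) ≤ suc (count (wrong? σ′))
    wrong-drop = count-mono-except (wrong? σ) (wrong? σ′) i
      (λ l l≢i → subst (λ l′ → σ l′ ≢ φ l) (sym (overwrite-≢ j l≢i)))

    -- The only newly placed value is `σ j`, so a copy can touch no class but that of `σ j`.
    untouched-other : ∀ k → class (σ j) ≢ suc k → Untouched σ k → Untouched σ′ k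
    untouched-other k class≢ unt l eq with l ≟ i
    ... | yes refl = contradiction eq class≢
    ... | no  _    = unt l eq

    untouched-drop : ∀ v → class (σ j) ≡ v → count (untouched? σ) ≤ suc (count (untouched? σ′))
    untouched-drop zero eq = m≤n⇒m≤1+n
      (count-mono (untouched? σ) (untouched? σ′)
        (λ k → untouched-other k λ eq′ → contradiction (trans (sym eq) eq′) λ ()))
    untouched-drop (suc v) eq = count-mono-except (untouched? σ) (untouched? σ′) v
      (λ k k≢v → untouched-other k λ eq′ → k≢v (suc-injective (trans (sym eq′) eq)))

    -- Copying a correct value from an untouched class to i destroys the only
    -- occurrence of the value i, which φ needs.
    destroyed : σ j ≡ φ i → (∀ k → ∃[ l ] σ′ l ≡ φ k) →
                ∀ k → Untouched σ k → class (σ j) ≢ suc k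
    destroyed σj≡φi live k unt class-σj = absurd (proj₁ occurrence ≟ i)
      where
      class-i : class i ≡ suc k
      class-i = trans (sym (class-φ i)) (trans (cong class (sym σj≡φi)) class-σj)

      occurrence : ∃[ l ] σ′ l ≡ i
      occurrence =
        let i′ , φi′≡i = class-preimage i class-i
        in map₂ (λ eq → trans eq φi′≡i) (live i′)

      absurd : Dec (proj₁ occurrence ≡ i) → ⊥
      absurd (yes l≡i) = class-moved i class-i (begin
        φ i                  ≡⟨ σj≡φi ⟨
        σ j                  ≡⟨ cong σ (overwrite-≡ i j) ⟨
        σ′ i                 ≡⟨ cong σ′ l≡i ⟨
        σ′ (proj₁ occurrence) ≡⟨ proj₂ occurrence ⟩
        i                    ∎)
        where open ≡-Reasoning
      absurd (no l≢i) =
        let l   = proj₁ occurrence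
            σl≡i = trans (cong σ (sym (overwrite-≢ j l≢i))) (proj₂ occurrence)
        in l≢i (trans (sym (unt l (trans (cong class σl≡i) class-i))) σl≡i)

    -- A copy cannot gain on both summands: a wrong value corrects no coordinate, and a correct
    -- value cannot come from an untouched class as long as all required values survive.
    potential-copy : (∀ k → ∃[ l ] σ′ l ≡ φ k) → potential σ ≤ suc (potential σ′)
    potential-copy live with σ j ≟ φ i
    ... | no σj≢φi = ≤-trans
      (+-mono-≤ (wrong-mono σj≢φi) (untouched-drop (class (σ j)) refl))
      (≤-reflexive (+-suc _ _))
    ... | yes σj≡φi = +-mono-≤ wrong-drop
      (count-mono (untouched? σ) (untouched? σ′)
        (λ k unt → untouched-other k (destroyed σj≡φi live k unt) unt))

-- Disjoint transpositions together with one collision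

module Swaps (m : ℕ) where

  Index : Set
  Index = Fin (suc m ℕ.* 2)

  pos : Fin (suc m) → Fin 2 → Index
  pos = combine

  coords : Index → Fin (suc m) × Fin 2
  coords = remQuot {suc m} 2

  coords-pos : ∀ k e → coords (pos k e) ≡ (k , e)
  coords-pos = remQuot-combine {suc m} {2}

  pos-injective : ∀ {k e k′ e′} → pos k e ≡ pos k′ e′ → (k , e) ≡ (k′ , e′)
  pos-injective {k} {e} {k′} {e′} eq =
    trans (sym (coords-pos k e)) (trans (cong coords eq) (coords-pos k′ e′))

  pos-elim : (P : Pred Index p) → (∀ k e → P (pos k e)) → ∀ i → P i
  pos-elim P P-pos i =
    subst P (combine-remQuot {suc m} 2 i) (P-pos (proj₁ (coords i)) (proj₂ (coords i)))

  -- Block `0` is the collapsed pair, whose index `pos 0F 1F` is free; the other blocks are the `m`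
  -- transpositions.
  flip : Fin (suc m) → Fin 2 → Fin 2
  flip zero    _ = 0F
  flip (suc _) e = opposite e

  swaps : Index → Index
  swaps i = pos (proj₁ (coords i)) (flip (proj₁ (coords i)) (proj₂ (coords i)))

  swaps-pos : ∀ k e → swaps (pos k e) ≡ pos k (flip k e)
  swaps-pos k e = cong (λ c → pos (proj₁ c) (flip (proj₁ c) (proj₂ c))) (coords-pos k e)

  swaps-moves : ∀ i → i ≢ pos 0F 0F → swaps i ≢ i
  swaps-moves = pos-elim (λ i → i ≢ pos 0F 0F → swaps i ≢ i) moves
    where
    moved : ∀ k e → flip k e ≢ e → swaps (pos k e) ≢ pos k e
    moved k e neq eq = neq (cong proj₂ (pos-injective {k} {flip k e} {k} {e} (trans (sym (swaps-pos k e)) eq)))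

    moves : ∀ k e → pos k e ≢ pos 0F 0F → swaps (pos k e) ≢ pos k e
    moves zero    0F neq = contradiction refl neq
    moves zero    1F _   = moved 0F 1F λ ()
    moves (suc k) 0F _   = moved (suc k) 0F λ ()
    moves (suc k) 1F _   = moved (suc k) 1F λ ()

  ∣support∣-swaps : suc m ℕ.* 2 ≤ suc (∣support∣ swaps)
  ∣support∣-swaps = subst (_≤ suc (∣support∣ swaps)) (count-all every? (λ _ → refl))
    (count-mono-except every? (support? swaps) (pos 0F 0F) (λ i neq _ → swaps-moves i neq))
    where
    every? : Decidable {A = Index} (λ i → i ≡ i)
    every? _ = yes refl

  swaps-classes : MovedClasses swaps m
  swaps-classes = record
    { class          = class
    ; member         = λ k → pos (suc k) 0F
    ; class-member   = λ k → class-pos (suc k) 0F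
    ; class-φ        = λ i → class-pos (class i) _
    ; class-moved    = λ i class-i → swaps-moves i λ { refl →
                         contradiction (trans (sym (class-pos 0F 0F)) class-i) λ () }
    ; class-preimage = λ {k} →
        pos-elim (λ i → class i ≡ suc k → ∃[ i′ ] swaps i′ ≡ i) preimage
    }
    where
    class : Index → Fin (suc m)
    class i = proj₁ (coords i)

    class-pos : ∀ k e → class (pos k e) ≡ k
    class-pos k e = cong proj₁ (coords-pos k e)

    preimage : ∀ {k} k′ e → class (pos k′ e) ≡ suc k → ∃[ i′ ] swaps i′ ≡ pos k′ e
    preimage zero     e eq = contradiction (trans (sym (class-pos 0F e)) eq) λ ()
    preimage (suc k′) e _  = pos (suc k′) (opposite e) ,
      trans (swaps-pos (suc k′) (opposite e)) (cong (pos (suc k′)) (opposite-involutive e))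

  swaps-nonPermutation : ¬ IsPermutation swaps
  swaps-nonPermutation (injective , _) = contradiction
    (pos-injective {0F} {0F} {0F} {1F}
      (injective (trans (swaps-pos 0F 0F) (sym (swaps-pos 0F 1F))))) λ ()

-- Addition modulo q

infixl 6 _⊕_ _⊖_

_⊕_ _⊖_ : {q : ℕ} .{{_ : NonZero q}} → Fin q → Fin q → Fin q
_⊕_ {q} x y = (toℕ x ℕ.+ toℕ y) mod q
_⊖_ {q} x y = (toℕ x ℕ.+ (q ∸ toℕ y)) mod q

⊕-comm : {q : ℕ} .{{_ : NonZero q}} (x y : Fin q) → x ⊕ y ≡ y ⊕ x
⊕-comm {q} x y = cong (_mod q) (+-comm (toℕ x) (toℕ y))

x⊕y⊖y≡x : {q : ℕ} .{{_ : NonZero q}} (x y : Fin q) → x ⊕ y ⊖ y ≡ x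
x⊕y⊖y≡x {q} x y = toℕ-injective (begin
  toℕ (x ⊕ y ⊖ y)                  ≡⟨ toℕ-fromℕ< _ ⟩
  (toℕ (x ⊕ y) ℕ.+ -Y) % q         ≡⟨ cong (λ z → (z ℕ.+ -Y) % q) (toℕ-fromℕ< _) ⟩
  ((X ℕ.+ Y) % q ℕ.+ -Y) % q       ≡⟨ %-distribˡ-+ ((X ℕ.+ Y) % q) -Y q ⟩
  ((X ℕ.+ Y) % q % q ℕ.+ -Y % q) % q ≡⟨ cong (λ z → (z ℕ.+ -Y % q) % q) (m%n%n≡m%n (X ℕ.+ Y) q) ⟩
  ((X ℕ.+ Y) % q ℕ.+ -Y % q) % q   ≡⟨ %-distribˡ-+ (X ℕ.+ Y) -Y q ⟨
  (X ℕ.+ Y ℕ.+ -Y) % q             ≡⟨ cong (_% q) (+-assoc X Y -Y) ⟩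
  (X ℕ.+ (Y ℕ.+ -Y)) % q           ≡⟨ cong (λ z → (X ℕ.+ z) % q) (m+[n∸m]≡n (<⇒≤ (toℕ<n y))) ⟩
  (X ℕ.+ q) % q                    ≡⟨ [m+n]%n≡m%n X q ⟩
  X % q                            ≡⟨ m<n⇒m%n≡m (toℕ<n x) ⟩
  X                                ∎)
  where
  open ≡-Reasoning
  X  = toℕ x
  Y  = toℕ y
  -Y = q ∸ Y

-- checksum f determines each single f k from the other values of f.
module Checksum {q : ℕ} .{{_ : NonZero q}} (0# : Fin q) where

  checksum : (Fin m → Fin q) → Fin q
  checksum {zero}  f = 0#
  checksum {suc m} f = f 0F ⊕ checksum (f ∘ suc)

  recover : Fin m → Fin q → (Fin m → Fin q) → Fin q
  recover zero    z f = z ⊖ checksum (f ∘ suc)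
  recover (suc k) z f = recover k (z ⊖ f 0F) (f ∘ suc)

  checksum-cong : {f g : Fin m → Fin q} → f ≗ g → checksum f ≡ checksum g
  checksum-cong {zero}  eq = refl
  checksum-cong {suc m} eq = cong₂ _⊕_ (eq 0F) (checksum-cong (eq ∘ suc))

  -- `recover k` subtracts the summands before `k` one by one and then the checksum of those after
  -- it. It never reads `g k`, which stands for the value already overwritten.
  recover-checksum : (k : Fin m) {f g : Fin m → Fin q} → (∀ j → j ≢ k → g j ≡ f j) →
                     recover k (checksum f) g ≡ f k
  recover-checksum zero {f} {g} eq =
    trans (cong (checksum f ⊖_) (checksum-cong (λ j → eq (suc j) λ ())))
          (x⊕y⊖y≡x (f 0F) _)
  recover-checksum (suc k) {f} {g} eq =
    trans (cong (λ z → recover k z (g ∘ suc)) head-removed)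
          (recover-checksum k (λ j j≢k → eq (suc j) (j≢k ∘ suc-injective)))
    where
    head-removed : checksum f ⊖ g 0F ≡ checksum (f ∘ suc)
    head-removed = trans (cong (checksum f ⊖_) (eq 0F λ ()))
      (trans (cong (_⊖ f 0F) (⊕-comm (f 0F) _)) (x⊕y⊖y≡x _ (f 0F)))

-- Programs over a finite alphabet

module Alphabet {a} {A : Set a} {q : ℕ} (A↔Fin : A ↔ Fin q) (2≤q : 2 ≤ q) where

  open Inverse A↔Fin using (to; from; strictlyInverseˡ; strictlyInverseʳ)

  -- Finite codes for tuples and transformations

  encode : Vec A n → Fin (q ℕ.^ n)
  encode x = funToFin (to ∘ lookup x)

  decode : Fin (q ℕ.^ n) → Vec A n
  decode c = tabulate (from ∘ finToFun c)

  decode-encode : (x : Vec A n) → decode (encode x) ≡ x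
  decode-encode x = trans
    (tabulate-cong (λ i → trans (cong from (finToFun-funToFin (to ∘ lookup x) i)) (strictlyInverseʳ _)))
    (tabulate∘lookup x)

  allVec? : {P : Pred (Vec A n) p} → Decidable P → Dec (∀ x → P x)
  allVec? {P = P} P? = map′ (λ all x → subst P (decode-encode x) (all (encode x))) (_∘ decode)
    (all? (P? ∘ decode))

  _≟ᴬ_ : (x y : A) → Dec (x ≡ y)
  x ≟ᴬ y = map′ (λ eq → trans (sym (strictlyInverseʳ x)) (trans (cong from eq) (strictlyInverseʳ y)))
    (cong to) (to x ≟ to y)

  _≟ⱽ_ : (x y : Vec A n) → Dec (x ≡ y)
  _≟ⱽ_ = ≡-dec _≟ᴬ_

  encodeᵀ : Transformation A n → Fin ((q ℕ.^ n) ℕ.^ (q ℕ.^ n))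
  encodeᵀ g = funToFin (encode ∘ g ∘ decode)

  decodeᵀ : Fin ((q ℕ.^ n) ℕ.^ (q ℕ.^ n)) → Transformation A n
  decodeᵀ c = decode ∘ finToFun c ∘ encode

  -- A code determines a transformation up to pointwise equality, so a property tested on codes has
  -- to respect `_≗_`.
  decodeᵀ-encodeᵀ : (g : Transformation A n) → decodeᵀ (encodeᵀ g) ≗ g
  decodeᵀ-encodeᵀ g x = begin
    decode (finToFun (encodeᵀ g) (encode x)) ≡⟨ cong decode (finToFun-funToFin (encode ∘ g ∘ decode) (encode x)) ⟩
    decode (encode (g (decode (encode x))))  ≡⟨ decode-encode _ ⟩
    g (decode (encode x))                    ≡⟨ cong g (decode-encode x) ⟩
    g x                                      ∎
    where open ≡-Reasoning

  trivialAt? : (g : Transformation A n) → Decidable (TrivialAt g)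
  trivialAt? g i = allVec? (λ x → lookup (g x) i ≟ᴬ lookup x i)

  instruction? : Decidable (IsInstruction {n = n} {A = A})
  instruction? g = all? (λ i → all? (λ j →
    ¬? (trivialAt? g i) →-dec (¬? (trivialAt? g j) →-dec (i ≟ j))))

  instruction-resp : {g h : Transformation A n} → g ≗ h → IsInstruction g → IsInstruction h
  instruction-resp g≗h inst i j ¬i ¬j = inst i j (¬i ∘ transport i) (¬j ∘ transport j)
    where
    transport = λ i triv x → trans (cong (λ y → lookup y i) (sym (g≗h x))) (triv x)

  blackBox? : Decidable (IsBlackBoxInstruction {n = n} {A = A})
  blackBox? g = any? (λ i → any? (λ j → allVec? (λ y → g y ≟ⱽ (y [ i ]≔ lookup y j))))

  blackBox-resp : {g h : Transformation A n} → g ≗ h →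
                  IsBlackBoxInstruction g → IsBlackBoxInstruction h
  blackBox-resp g≗h (i , j , eq) = i , j , λ y → trans (sym (g≗h y)) (eq y)

  -- Existence of shortest programs

  module Search {Q : Pred (Transformation A n) a} (Q? : Decidable Q)
                (Q-resp : ∀ {g h} → g ≗ h → Q g → Q h) (f : Transformation A n) where

    -- `pre` accumulates the effect of the instructions already chosen, so that the search can
    -- recurse on the number of those still to come.
    ProgramAfter : Transformation A n → ℕ → Set a
    ProgramAfter pre ℓ = ∃[ gs ] ((All Q gs × run gs ∘ pre ≗ f) × length gs ≡ ℓ)

    programAfter? : ∀ pre → Decidable (ProgramAfter pre)
    programAfter? pre zero = map′ (λ eq → [] , ([] , eq) , refl)
      (λ { ([] , (_ , eq) , refl) → eq }) (allVec? (λ x → pre x ≟ⱽ f x))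
    programAfter? pre (suc ℓ) = map′
      (λ { (c , Qc , gs , (Qgs , eq) , refl) → decodeᵀ c ∷ gs , (Qc ∷ Qgs , eq) , refl })
      (λ { (g ∷ gs , (Qg ∷ Qgs , eq) , refl) →
           encodeᵀ g , Q-resp (sym ∘ decodeᵀ-encodeᵀ g) Qg , gs ,
           (Qgs , λ x → trans (cong (run gs) (decodeᵀ-encodeᵀ g (pre x))) (eq x)) , refl })
      (any? (λ c → Q? (decodeᵀ c) ×-dec programAfter? (decodeᵀ c ∘ pre) ℓ))

    -- The given program bounds the search: the length descends as long as a strictly shorter
    -- program exists.
    minLength : ∃[ gs ] (All Q gs × run gs ≗ f) →
                ∃[ ℓ ] IsMinLength (λ gs → All Q gs × run gs ≗ f) ℓ
    minLength (gs , prog) = go (length gs) (<-wellFounded _) (gs , prog , refl)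
      where
      go : ∀ ℓ → Acc ℕ._<_ ℓ → ProgramAfter id ℓ → ∃[ ℓ ] IsMinLength (λ gs → All Q gs × run gs ≗ f) ℓ
      go ℓ (acc rec) prog with anyUpTo? (programAfter? id) ℓ
      ... | yes (k , k<ℓ , shorter) = go k (rec k<ℓ) shorter
      ... | no ¬shorter = ℓ , prog , λ hs prog′ →
        ≮⇒≥ (λ hs<ℓ → ¬shorter (length hs , hs<ℓ , hs , prog′ , refl))

  -- Lower bound for programs of arbitrary instructions

  nontrivial? : (g : Transformation A n) → Decidable (λ i → ¬ TrivialAt g i)
  nontrivial? g i = ¬? (trivialAt? g i)

  -- If `k` is nontrivial for the first instruction, that instruction is trivial everywhere else, so
  -- it adds at most `k` to the nontrivial coordinates of the rest.
  nontrivial≤length : (gs : List (Transformation A n)) → All IsInstruction gs →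
                      count (nontrivial? (run gs)) ≤ length gs
  nontrivial≤length {n = n} [] [] = ≤-reflexive
    (count-none (nontrivial? {n = n} id) (λ _ ¬triv → ¬triv (λ _ → refl)))
  nontrivial≤length (g ∷ gs) (inst ∷ insts) with any? (nontrivial? g)
  ... | yes (k , ¬triv) = ≤-trans
    (count-mono-except (nontrivial? (run (g ∷ gs))) (nontrivial? (run gs)) k
      (λ i i≢k ¬run triv → ¬run λ x → trans (triv (g x))
        (decidable-stable (trivialAt? g i) (λ ¬trivᵢ → i≢k (inst i k ¬trivᵢ ¬triv)) x)))
    (s≤s (nontrivial≤length gs insts))
  ... | no ¬nontriv = ≤-trans
    (count-mono (nontrivial? (run (g ∷ gs))) (nontrivial? (run gs))
      (λ i ¬run triv → ¬run λ x → trans (triv (g x))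
        (decidable-stable (trivialAt? g i) (λ ¬trivᵢ → ¬nontriv (i , ¬trivᵢ)) x)))
    (m≤n⇒m≤1+n (nontrivial≤length gs insts))

  distinct : Σ[ x ∈ A ] Σ[ y ∈ A ] x ≢ y
  distinct = go 2≤q to from strictlyInverseˡ
    where
    go : ∀ {q} → 2 ≤ q → (to : A → Fin q) (from : Fin q → A) → to ∘ from ≗ id →
         Σ[ x ∈ A ] Σ[ y ∈ A ] x ≢ y
    go (s≤s (s≤s _)) to from inv = from 0F , from 1F , λ eq →
      contradiction (trans (sym (inv 0F)) (trans (cong to eq) (inv 1F))) λ ()

  private
    a₀ a₁ : A
    a₀ = proj₁ distinct
    a₁ = proj₁ (proj₂ distinct)

    a₀≢a₁ : a₀ ≢ a₁
    a₀≢a₁ = proj₂ (proj₂ distinct)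

  δ : Fin n → Vec A n
  δ i = replicate _ a₀ [ i ]≔ a₁

  lookup-δ-≢ : {i k : Fin n} → k ≢ i → lookup (δ i) k ≡ a₀
  lookup-δ-≢ {k = k} k≢i = trans (lookup∘update′ k≢i (replicate _ a₀) a₁) (lookup-replicate k a₀)

  -- The tuple `δ j` has `a₁` at `j` and `a₀` elsewhere, which tells `j` apart from every other
  -- index because `A` has two distinct elements.
  separate : {i j : Fin n} → (∀ x → lookup x i ≡ lookup x j) → i ≡ j
  separate {i = i} {j} eq with i ≟ j
  ... | yes i≡j = i≡j
  ... | no  i≢j = contradiction
    (trans (sym (lookup-δ-≢ i≢j)) (trans (eq (δ j)) (lookup∘update j (replicate _ a₀) a₁))) a₀≢a₁

  lookup-manipulation : (φ : Fin n → Fin n) (x : Vec A n) (i : Fin n) →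
                        lookup (manipulation A φ x) i ≡ lookup x (φ i)
  lookup-manipulation φ x i = lookup∘tabulate _ i

  vec-ext : {x y : Vec A n} → lookup x ≗ lookup y → x ≡ y
  vec-ext {x = x} {y} eq = trans (sym (tabulate∘lookup x)) (trans (tabulate-cong eq) (tabulate∘lookup y))

  manipulation-injective : {σ φ : Fin n → Fin n} → manipulation A σ ≗ manipulation A φ → σ ≗ φ
  manipulation-injective {σ = σ} {φ} eq i = separate λ x →
    trans (sym (lookup-manipulation σ x i))
      (trans (cong (λ y → lookup y i) (eq x)) (lookup-manipulation φ x i))

  ∣support∣≤length : (φ : Fin n → Fin n) (gs : List (Transformation A n)) →
                     IsProgramFor (manipulation A φ) gs → ∣support∣ φ ≤ length gs
  ∣support∣≤length φ gs (insts , computes) = ≤-trans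
    (count-mono (support? φ) (nontrivial? (run gs)) ⊆)
    (nontrivial≤length gs insts)
    where
    ⊆ : ∀ k → φ k ≢ k → ¬ TrivialAt (run gs) k
    ⊆ k φk≢k triv = φk≢k (separate λ x → trans (sym (lookup-manipulation φ x k))
      (trans (cong (λ y → lookup y k) (sym (computes x))) (triv x)))

  -- The state after a black box program is manipulation A σ of the input, for
  -- an index map σ that each instruction precomposes with an overwrite.
  step-manipulation : (σ : Fin n → Fin n) (i j : Fin n) (x : Vec A n) →
    manipulation A σ x [ i ]≔ lookup (manipulation A σ x) j ≡ manipulation A (σ ∘ overwrite i j) x
  step-manipulation σ i j x = vec-ext λ k →
    trans (pointwise k) (sym (lookup-manipulation (σ ∘ overwrite i j) x k))
    where
    pointwise : ∀ k → lookup (manipulation A σ x [ i ]≔ lookup (manipulation A σ x) j) k ≡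
                      lookup x (σ (overwrite i j k))
    pointwise k with k ≟ i
    ... | yes refl = trans (lookup∘update i (manipulation A σ x) _) (lookup-manipulation σ x j)
    ... | no  k≢i  = trans (lookup∘update′ k≢i (manipulation A σ x) _) (lookup-manipulation σ x k)

  manipulation-id : (x : Vec A n) → manipulation A id x ≡ x
  manipulation-id = tabulate∘lookup

  Compiles⇒program : {φ : Fin n → Fin n} → Compiles φ ℓ →
                     ∃[ gs ] (IsBlackBoxProgramFor (manipulation A φ) gs × length gs ≡ ℓ)
  Compiles⇒program (halt φ≗id) = [] ,
    ([] , λ x → sym (trans (tabulate-cong (cong (lookup x) ∘ φ≗id)) (tabulate∘lookup x))) , refl
  Compiles⇒program {φ = φ} (copy {ψ = ψ} i j eq prog) with Compiles⇒program prog
  ... | gs , (bbs , computes) , refl =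
    (λ y → y [ i ]≔ lookup y j) ∷ gs , ((i , j , λ _ → refl) ∷ bbs , computes′) , refl
    where
    computes′ : ∀ x → run gs (x [ i ]≔ lookup x j) ≡ manipulation A φ x
    computes′ x = trans (computes _) (vec-ext λ k → begin
      lookup (manipulation A ψ (x [ i ]≔ lookup x j)) k  ≡⟨ lookup-manipulation ψ (x [ i ]≔ lookup x j) k ⟩
      lookup (x [ i ]≔ lookup x j) (ψ k)
        -- The input is rewritten as the state of the identity index map, to which
        -- `step-manipulation` applies.
        ≡⟨ cong (λ y → lookup (y [ i ]≔ lookup y j) (ψ k)) (manipulation-id x) ⟨
      lookup (manipulation A id x [ i ]≔ lookup (manipulation A id x) j) (ψ k)
        ≡⟨ cong (λ y → lookup y (ψ k)) (step-manipulation id i j x) ⟩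
      lookup (manipulation A (overwrite i j) x) (ψ k)    ≡⟨ lookup-manipulation (overwrite i j) x (ψ k) ⟩
      lookup x (overwrite i j (ψ k))                     ≡⟨ cong (lookup x) (eq k) ⟩
      lookup x (φ k)                                     ≡⟨ lookup-manipulation φ x k ⟨
      lookup (manipulation A φ x) k                      ∎)
      where open ≡-Reasoning

  -- A value absent from the current state cannot influence the outcome.
  live : {σ φ : Fin n → Fin n} (F : Transformation A n) →
         F ∘ manipulation A σ ≗ manipulation A φ → ∀ i → ∃[ l ] σ l ≡ φ i
  live {n = n} {σ = σ} {φ} F eq i with any? (λ l → σ l ≟ φ i)
  ... | yes found = found
  ... | no ¬found = contradiction same a₀≢a₁
    where
    open ≡-Reasoning
    x₀ : Vec A n
    x₀ = replicate n a₀
    states : manipulation A σ x₀ ≡ manipulation A σ (δ (φ i))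
    states = tabulate-cong λ l →
      trans (lookup-replicate (σ l) a₀) (sym (lookup-δ-≢ (λ σl≡φi → ¬found (l , σl≡φi))))
    same : a₀ ≡ a₁
    same = begin
      a₀                                               ≡⟨ lookup-replicate (φ i) a₀ ⟨
      lookup x₀ (φ i)                                  ≡⟨ lookup-manipulation φ x₀ i ⟨
      lookup (manipulation A φ x₀) i                   ≡⟨ cong (λ y → lookup y i) (eq x₀) ⟨
      lookup (F (manipulation A σ x₀)) i               ≡⟨ cong (λ y → lookup (F y) i) states ⟩
      lookup (F (manipulation A σ (δ (φ i)))) i        ≡⟨ cong (λ y → lookup y i) (eq (δ (φ i))) ⟩
      lookup (manipulation A φ (δ (φ i))) i            ≡⟨ lookup-manipulation φ (δ (φ i)) i ⟩
      lookup (δ (φ i)) (φ i)                           ≡⟨ lookup∘update (φ i) x₀ a₁ ⟩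
      a₁                                               ∎

  -- The potential starts at `∣support∣ φ + m`, ends at `0` and falls by at most one per copy. The
  -- rest of the program still computes `φ`, so `live` supplies the survival of the required values.
  blackBox-bound : {φ : Fin n → Fin n} → MovedClasses φ m →
                   ∀ gs → IsBlackBoxProgramFor (manipulation A φ) gs → ∣support∣ φ ℕ.+ m ≤ length gs
  blackBox-bound {n = n} {φ = φ} classes gs (bbs , computes) =
    subst (_≤ length gs) potential-id
      (go id gs bbs (λ x → trans (cong (run gs) (manipulation-id x)) (computes x)))
    where
    open Potential classes

    go : ∀ σ gs → All IsBlackBoxInstruction gs →
         run gs ∘ manipulation A σ ≗ manipulation A φ → potential σ ≤ length gs
    go σ [] [] eq = ≤-reflexive (potential-done (manipulation-injective eq))
    go σ (g ∷ gs) ((i , j , g-eq) ∷ bbs) eq = ≤-trans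
      (potential-copy σ i j (live (run gs) eq′))
      (s≤s (go (σ ∘ overwrite i j) gs bbs eq′))
      where
      eq′ : run gs ∘ manipulation A (σ ∘ overwrite i j) ≗ manipulation A φ
      eq′ x = trans (cong (run gs) (sym (trans (g-eq _) (step-manipulation σ i j x)))) (eq x)

  blackBox⇒program : {f : Transformation A n} {gs : List (Transformation A n)} →
                     IsBlackBoxProgramFor f gs → IsProgramFor f gs
  blackBox⇒program (bbs , computes) = All.map blackBox⇒instruction bbs , computes

  -- Both complexities and the bound between them

  record Minima (φ : Fin n → Fin n) : Set a where
    field
      complexity           : ℕ
      blackBoxComplexity   : ℕ
      isComplexity         : IsProceduralComplexity (manipulation A φ) complexity
      isBlackBoxComplexity : IsBlackBoxComplexity (manipulation A φ) blackBoxComplexity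
      nonZero              : NonZero blackBoxComplexity
      two-thirds           : 2 ℕ.* blackBoxComplexity ℕ.< 3 ℕ.* complexity

    ratio : ℚ
    ratio = (+ complexity / blackBoxComplexity) ⦃ nonZero ⦄

    isRatio : IsRatio A φ ratio
    isRatio = record
      { isComplexity         = isComplexity
      ; isBlackBoxComplexity = isBlackBoxComplexity
      ; nonZero              = nonZero
      ; ratio                = refl
      }

  minima : (φ : Fin n → Fin n) → ∃[ t ] Free φ t → Minima φ
  minima φ (t , free) =
    let f = manipulation A φ
        ℓ , prog , 2ℓ<3s = compile φ (t , free)
        gs , bb , ℓ-eq   = Compiles⇒program prog
        c , isC          = Search.minLength instruction? instruction-resp f (gs , blackBox⇒program bb)
        b , isB          = Search.minLength blackBox? blackBox-resp f (gs , bb)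
        hs , hs-prog , hs-length = proj₁ isC
        ks , ks-prog , ks-length = proj₁ isB
        s≤c = subst (∣support∣ φ ≤_) hs-length (∣support∣≤length φ hs hs-prog)
        s≤b = subst (∣support∣ φ ≤_) ks-length (∣support∣≤length φ ks (blackBox⇒program ks-prog))
        b≤ℓ = subst (b ≤_) ℓ-eq (proj₂ isB gs bb)
    in record
      { complexity           = c
      ; blackBoxComplexity   = b
      ; isComplexity         = isC
      ; isBlackBoxComplexity = isB
      -- The free index is moved, so the support is nonempty and bounds `b` away from zero.
      ; nonZero              = ℕ.>-nonZero (≤-trans (≤-trans (s≤s z≤n) (∣support∣-retire free)) s≤b)
      -- With `s` the size of the support, `2b ≤ 2ℓ < 3s ≤ 3c`.
      ; two-thirds           = ≤-trans (s≤s (*-monoʳ-≤ 2 b≤ℓ)) (≤-trans 2ℓ<3s (*-monoʳ-≤ 3 s≤c))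
      }

  blackBoxComplexity-bound : {φ : Fin n → Fin n} → MovedClasses φ m →
                             IsBlackBoxComplexity (manipulation A φ) ℓ → ∣support∣ φ ℕ.+ m ≤ ℓ
  blackBoxComplexity-bound classes ((gs , prog , refl) , _) = blackBox-bound classes gs prog

  -- A short program for the transpositions

  assign : Fin n → (Vec A n → A) → Transformation A n
  assign i h y = y [ i ]≔ h y

  assign-instruction : (i : Fin n) (h : Vec A n → A) → IsInstruction (assign i h)
  assign-instruction i h j k ¬j ¬k = trans (written j ¬j) (sym (written k ¬k))
    where
    written : ∀ j → ¬ TrivialAt (assign i h) j → j ≡ i
    written j ¬triv = decidable-stable (j ≟ i) (λ j≢i → ¬triv (λ x → lookup∘update′ j≢i x (h x)))

  -- The checksum of one side of all the transpositions is stored in pos 0F 1F.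
  -- It is never rewritten while the transpositions are executed, so that each
  -- of them costs two instructions instead of three.
  module SwapProgram (m : ℕ) where

    open Swaps m

    private instance
      q≢0 : NonZero q
      q≢0 = ℕ.>-nonZero (≤-trans (s≤s z≤n) 2≤q)

    open Checksum (to a₀)

    State : Set a
    State = Vec A (suc m ℕ.* 2)

    _at_ : State → Fin (suc m) → Fin 2 → A
    (y at k) e = lookup y (pos k e)

    at-assign-≡ : ∀ k e h (y : State) → (assign (pos k e) h y at k) e ≡ h y
    at-assign-≡ k e h y = lookup∘update (pos k e) y (h y)

    at-assign-≢ : ∀ k e k′ e′ h (y : State) → (k′ , e′) ≢ (k , e) →
                  (assign (pos k e) h y at k′) e′ ≡ (y at k′) e′
    at-assign-≢ k e k′ e′ h y neq =
      lookup∘update′ (λ eq → neq (pos-injective {k′} {e′} {k} {e} eq)) y (h y)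

    firsts : State → Fin m → Fin q
    firsts x k = to ((x at suc k) 0F)

    open import Data.List.Membership.DecPropositional (_≟_ {m}) using (_∈_; _∈?_)

    -- Where the input value of side `0F` can be read: at `0F` while the transposition is pending,
    -- at `1F` once it is done.
    side : (ks : List (Fin m)) → Fin m → Fin 2
    side ks j with j ∈? ks
    ... | yes _ = 0F
    ... | no  _ = 1F

    current : List (Fin m) → State → Fin m → Fin q
    current ks y j = to ((y at suc j) (side ks j))

    restore : Fin m → List (Fin m) → State → A
    restore k ks y = from (recover k (to ((y at 0F) 1F)) (current ks y))

    rounds : List (Fin m) → List (Transformation A (suc m ℕ.* 2))
    -- With no transposition left, the checksum gives way to the final value of its coordinate.
    rounds []       = assign (pos 0F 1F) (λ y → (y at 0F) 0F) ∷ []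
    rounds (k ∷ ks) = assign (pos (suc k) 0F) (λ y → (y at suc k) 1F)
                    ∷ assign (pos (suc k) 1F) (restore k ks)
                    ∷ rounds ks

    program : List (Transformation A (suc m ℕ.* 2))
    program = assign (pos 0F 1F) (λ y → from (checksum (firsts y))) ∷ rounds (allFin m)

    -- ks lists the transpositions still to be executed.
    record Pending (x : State) (ks : List (Fin m)) (y : State) : Set a where
      field
        stored  : (y at 0F) 1F ≡ from (checksum (firsts x))
        fixed   : (y at 0F) 0F ≡ (x at 0F) 0F
        pending : ∀ j e → j ∈ ks → (y at suc j) e ≡ (x at suc j) e
        done    : ∀ j e → ¬ j ∈ ks → (y at suc j) e ≡ (x at suc j) (opposite e)

    -- The first assignment overwrites side `0F` of transposition `k`. The lost value is the
    -- checksum minus the corresponding values of all other transpositions, each still readable on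
    -- its current side.
    Pending-round : ∀ {x k ks y} → All (k ≢_) ks → Pending x (k ∷ ks) y →
      Pending x ks (assign (pos (suc k) 1F) (restore k ks)
                     (assign (pos (suc k) 0F) (λ y → (y at suc k) 1F) y))
    Pending-round {x} {k} {ks} {y} k∉ks inv = record
      { stored  = trans (frame 0F 1F (λ ()) (λ ())) stored
      ; fixed   = trans (frame 0F 0F (λ ()) (λ ())) fixed
      ; pending = λ j e j∈ks → trans (elsewhere j e λ { refl → All.lookup k∉ks j∈ks refl })
                                     (pending j e (there j∈ks))
      ; done    = done′
      }
      where
      open Pending inv
      h₁ = λ (y : State) → (y at suc k) 1F
      y₁ = assign (pos (suc k) 0F) h₁ y
      y₂ = assign (pos (suc k) 1F) (restore k ks) y₁

      frame : ∀ k′ e′ → (k′ , e′) ≢ (suc k , 1F) → (k′ , e′) ≢ (suc k , 0F) →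
              (y₂ at k′) e′ ≡ (y at k′) e′
      frame k′ e′ neq₁ neq₀ =
        trans (at-assign-≢ (suc k) 1F k′ e′ (restore k ks) y₁ neq₁) (at-assign-≢ (suc k) 0F k′ e′ h₁ y neq₀)

      elsewhere : ∀ j e → j ≢ k → (y₂ at suc j) e ≡ (y at suc j) e
      elsewhere j e j≢k = frame (suc j) e (λ { refl → j≢k refl }) (λ { refl → j≢k refl })

      current-others : ∀ j → j ≢ k → current ks y₁ j ≡ firsts x j
      current-others j j≢k = cong to (trans
        (at-assign-≢ (suc k) 0F (suc j) (side ks j) h₁ y (λ eq → j≢k (suc-injective (cong proj₁ eq))))
        side-value)
        where
        side-value : (y at suc j) (side ks j) ≡ (x at suc j) 0F
        side-value with j ∈? ks
        ... | yes j∈ks = pending j 0F (there j∈ks)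
        ... | no  j∉ks = done j 1F λ { (here j≡k) → j≢k j≡k ; (there j∈ks) → j∉ks j∈ks }

      restored : restore k ks y₁ ≡ (x at suc k) 0F
      restored = begin
        from (recover k (to ((y₁ at 0F) 1F)) (current ks y₁))
          ≡⟨ cong (λ z → from (recover k (to z) (current ks y₁)))
               (trans (at-assign-≢ (suc k) 0F 0F 1F h₁ y λ ()) stored) ⟩
        from (recover k (to (from (checksum (firsts x)))) (current ks y₁))
          ≡⟨ cong (λ z → from (recover k z (current ks y₁))) (strictlyInverseˡ _) ⟩
        from (recover k (checksum (firsts x)) (current ks y₁))
          ≡⟨ cong from (recover-checksum k current-others) ⟩
        from (to ((x at suc k) 0F))
          ≡⟨ strictlyInverseʳ _ ⟩
        (x at suc k) 0F ∎
        where open ≡-Reasoning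

      done′ : ∀ j e → ¬ j ∈ ks → (y₂ at suc j) e ≡ (x at suc j) (opposite e)
      done′ j e j∉ks with j ≟ k
      done′ j e  j∉ks | no j≢k = trans (elsewhere j e j≢k)
        (done j e λ { (here j≡k) → j≢k j≡k ; (there j∈ks) → j∉ks j∈ks })
      done′ j 0F j∉ks | yes refl = trans (at-assign-≢ (suc k) 1F (suc k) 0F (restore k ks) y₁ λ ())
        (trans (at-assign-≡ (suc k) 0F h₁ y) (pending k 1F (here refl)))
      done′ j 1F j∉ks | yes refl = trans (at-assign-≡ (suc k) 1F (restore k ks) y₁) restored

    Pending-finish : ∀ {x y} → Pending x [] y →
                     run (rounds []) y ≡ manipulation A swaps x
    Pending-finish {x} {y} inv = vec-ext
      (pos-elim (λ i → lookup y′ i ≡ lookup (manipulation A swaps x) i) pointwise)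
      where
      open Pending inv
      h = λ (y : State) → (y at 0F) 0F
      y′ = assign (pos 0F 1F) h y

      value : ∀ k e → (y′ at k) e ≡ (x at k) (flip k e)
      value zero    0F = trans (at-assign-≢ 0F 1F 0F 0F h y λ ()) fixed
      value zero    1F = trans (at-assign-≡ 0F 1F h y) fixed
      value (suc k) e  = trans (at-assign-≢ 0F 1F (suc k) e h y λ ()) (done k e λ ())

      pointwise : ∀ k e → lookup y′ (pos k e) ≡ lookup (manipulation A swaps x) (pos k e)
      pointwise k e = trans (value k e)
        (sym (trans (lookup-manipulation swaps x (pos k e)) (cong (lookup x) (swaps-pos k e))))

    run-rounds : ∀ {x} ks {y} → Unique ks → Pending x ks y →
                 run (rounds ks) y ≡ manipulation A swaps x
    run-rounds []       []             inv = Pending-finish inv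
    run-rounds (k ∷ ks) (k∉ks ∷ uniq) inv = run-rounds ks uniq (Pending-round k∉ks inv)

    program-correct : IsProgramFor (manipulation A swaps) program
    program-correct = assign-instruction _ _ ∷ instructions (allFin m) ,
      λ x → run-rounds {x} (allFin m) (allFin⁺ m) record
        { stored  = at-assign-≡ 0F 1F h x
        ; fixed   = at-assign-≢ 0F 1F 0F 0F h x λ ()
        ; pending = λ j e _ → at-assign-≢ 0F 1F (suc j) e h x λ ()
        ; done    = λ j e j∉ → contradiction (∈-allFin j) j∉
        }
      where
      h = λ (y : State) → from (checksum (firsts y))

      instructions : ∀ ks → All IsInstruction (rounds ks)
      instructions []       = assign-instruction _ _ ∷ []
      instructions (k ∷ ks) = assign-instruction _ _ ∷ assign-instruction _ _ ∷ instructions ks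

    length-program : length program ≡ suc m ℕ.* 2
    length-program = cong suc (trans (length-rounds (allFin m))
      (cong (λ l → suc (l ℕ.* 2)) {length (allFin m)} {m} (length-tabulate id)))
      where
      length-rounds : ∀ ks → length (rounds ks) ≡ suc (length ks ℕ.* 2)
      length-rounds []       = refl
      length-rounds (k ∷ ks) = cong (2 ℕ.+_) (length-rounds ks)

    module _ (minima : Minima swaps) where

      open Minima minima

      swaps-complexity : complexity ≤ suc m ℕ.* 2
      swaps-complexity = subst (complexity ≤_) length-program
        (proj₂ isComplexity program program-correct)

      -- The support has at least `2m + 1` elements and each transposition costs one more copy,
      -- hence at least `3m + 1` copies.
      swaps-blackBoxComplexity : suc m ℕ.* 2 ℕ.+ m ≤ suc blackBoxComplexity
      swaps-blackBoxComplexity = ≤-trans (+-monoˡ-≤ m ∣support∣-swaps)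
        (s≤s (blackBoxComplexity-bound swaps-classes isBlackBoxComplexity))

-- Comparison of fractions

/-<ᵘ : ∀ c b .{{_ : NonZero b}} r → (+ c ℚᵘ./ b) ℚᵘ.< toℚᵘ r → (+ c / b) < r
/-<ᵘ c b@(suc _) r c/b<r = toℚᵘ-cancel-< (ℚᵘ.<-respˡ-≃ (ℚᵘ.≃-sym (toℚᵘ-fromℚᵘ (+ c ℚᵘ./ b))) c/b<r)

2/3< : ∀ c b .{{_ : NonZero b}} → 2 ℕ.* b ℕ.< 3 ℕ.* c → + 2 / 3 < + c / b
2/3< c b@(suc _) 2b<3c = /-<ᵘ 2 3 (+ c / b)
  (ℚᵘ.<-respʳ-≃ (ℚᵘ.≃-sym (toℚᵘ-fromℚᵘ (+ c ℚᵘ./ b)))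
    (ℚᵘ.*<* (subst₂ ℤ._<_ (ℤ.pos-* 2 b) (ℤ.pos-* c 3)
      (ℤ.+<+ (subst (2 ℕ.* b ℕ.<_) (*-comm 3 c) 2b<3c)))))

-- With m the denominator d of ε, the ratio is at most 2(m + 1) / (3m + 1),
-- which lies below 2/3 + 1/d.
<2/3+ε : ∀ (ε : ℚ) → 0ℚ < ε → ∀ c b .{{_ : NonZero b}} → let m = ↧ₙ ε in
         c ≤ suc m ℕ.* 2 → suc m ℕ.* 2 ℕ.+ m ≤ suc b → + c / b < + 2 / 3 + ε
<2/3+ε ε@(mkℚ (+ 0) _ _)      0<ε = contradiction 0<ε (λ { (*<* (ℤ.+<+ ())) })
<2/3+ε ε@(mkℚ -[1+ _ ] _ _)   0<ε = contradiction 0<ε (λ { (*<* ()) })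
<2/3+ε ε@(mkℚ (+ suc p) d-1 _) 0<ε c b@(suc _) c≤ ≤b = /-<ᵘ c b (+ 2 / 3 + ε)
  (ℚᵘ.<-respʳ-≃ (ℚᵘ.≃-sym (toℚᵘ-homo-+ (+ 2 / 3) ε))
    (ℚᵘ.*<* (subst₂ ℤ._<_ (ℤ.pos-* c (3 ℕ.* d)) (ℤ.pos-* (2 ℕ.* d ℕ.+ suc p ℕ.* 3) b)
      (ℤ.+<+ key))))
  where
  d = suc d-1
  key : c ℕ.* (3 ℕ.* d) ℕ.< (2 ℕ.* d ℕ.+ suc p ℕ.* 3) ℕ.* b
  key = begin-strict
    c ℕ.* (3 ℕ.* d)                       ≤⟨ *-monoˡ-≤ (3 ℕ.* d) c≤ ⟩
    -- The product `(2d + 3)(3d + 1)` exceeds `6d(d + 1)` by exactly `5d + 3`.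
    suc d ℕ.* 2 ℕ.* (3 ℕ.* d)             <⟨ m<m+n _ (s≤s z≤n) ⟩
    suc d ℕ.* 2 ℕ.* (3 ℕ.* d) ℕ.+ suc (5 ℕ.* d ℕ.+ 2) ≡⟨ expand d ⟩
    (2 ℕ.* d ℕ.+ 3) ℕ.* (suc (d ℕ.* 2) ℕ.+ d)
      ≤⟨ *-mono-≤ (+-monoʳ-≤ (2 ℕ.* d) (m≤m+n 3 (p ℕ.* 3))) (ℕ.s≤s⁻¹ ≤b) ⟩
    (2 ℕ.* d ℕ.+ suc p ℕ.* 3) ℕ.* b       ∎
    where
    open ≤-Reasoning
    expand : ∀ d → suc d ℕ.* 2 ℕ.* (3 ℕ.* d) ℕ.+ suc (5 ℕ.* d ℕ.+ 2) ≡
                       (2 ℕ.* d ℕ.+ 3) ℕ.* (suc (d ℕ.* 2) ℕ.+ d)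
    expand = solve-∀

corollary2 : ∀ {a} (A : Set a) (q : ℕ) → A ↔ Fin q → 2 ≤ q →
    (∀ n → 2 ≤ n → (φ : Fin n → Fin n) → ¬ IsPermutation φ →
    ∃[ r ] (IsRatio A φ r × + 2 / 3 < r))
    × (∀ (ε : ℚ) → 0ℚ < ε →
    ∃[ n ] (2 ≤ n × Σ[ φ ∈ (Fin n → Fin n) ] (¬ IsPermutation φ ×
    ∃[ r ] (IsRatio A φ r × r < + 2 / 3 + ε))))
corollary2 A q A↔Fin 2≤q = lower , upper
  where
  open Alphabet A↔Fin 2≤q

  lower : ∀ n → 2 ≤ n → (φ : Fin n → Fin n) → ¬ IsPermutation φ →
          ∃[ r ] (IsRatio A φ r × + 2 / 3 < r)
  lower n _ φ ¬perm = ratio , isRatio , 2/3< complexity blackBoxComplexity ⦃ nonZero ⦄ two-thirds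
    where open Minima (minima φ (nonPermutation⇒free φ ¬perm))

  upper : ∀ (ε : ℚ) → 0ℚ < ε →
          ∃[ n ] (2 ≤ n × Σ[ φ ∈ (Fin n → Fin n) ] (¬ IsPermutation φ ×
          ∃[ r ] (IsRatio A φ r × r < + 2 / 3 + ε)))
  upper ε 0<ε = suc (↧ₙ ε) ℕ.* 2 , s≤s (s≤s z≤n) , swaps , swaps-nonPermutation ,
    bounded (minima swaps (nonPermutation⇒free swaps swaps-nonPermutation))
    where
    open Swaps (↧ₙ ε)
    open SwapProgram (↧ₙ ε)

    bounded : Minima swaps → ∃[ r ] (IsRatio A swaps r × r < + 2 / 3 + ε)
    bounded M = ratio , isRatio , <2/3+ε ε 0<ε complexity blackBoxComplexity ⦃ nonZero ⦄
      (swaps-complexity M) (swaps-blackBoxComplexity M)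
      where open Minima M
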